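{- For any two integers $p,q$ with $q\geq 2p-1$, $p\geq 2$ and $q\geq 3$, there exists a graph $G$ such that $\pi_3(G)=p$ and $\pi_3(L(G))=q$, where $L(G)$ denotes the line graph of $G$.
   Context: All graphs are finite, simple and undirected. For a graph $G$ and a set $S\subseteq V(G)$ with $|S|\geq 2$, an $S$-path (path connecting $S$) is a subgraph $P$ of $G$ that is a path with $S\subseteq V(P)$. Two $S$-paths $P,P'$ are internally disjoint if $E(P)\cap E(P')=\varnothing$ and $V(P)\cap V(P')=S$. The local path connectivity $\pi_G(S)$ is the maximum number of pairwise internally disjoint $S$-paths in $G$. For an integer $k$ with $2\leq k\leq |V(G)|$, the path $k$-connectivity is $\pi_k(G)=\min\{\pi_G(S) : S\subseteq V(G),\ |S|=k\}$. -}

module Defs where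

open import Data.Nat using (ℕ; _≤_)
open import Data.Fin using (Fin; _≟_; _<?_)
open import Data.Fin.Subset using (Subset; _∈_; ∣_∣)
open import Data.Bool using (Bool; true; false; _∧_; _∨_; not)
open import Data.List using (List; []; _∷_; length; filter; cartesianProduct; allFin; lookup)
import Data.List.Membership.Propositional as LM
open import Data.List.Relation.Unary.Linked using (Linked)
open import Data.List.Relation.Unary.Unique.Propositional using (Unique)
open import Data.Product using (Σ; ∃; _×_; _,_; proj₁; proj₂)
open import Data.Sum using (_⊎_)
open import Relation.Nullary using (¬_; yes; no)
open import Relation.Nullary.Decidable using (⌊_⌋; _×-dec_)
open import Relation.Binary.PropositionalEquality using (_≡_; refl; cong)

record Graph : Set where
  field
    n      : ℕ
    adj    : Fin n → Fin n → Bool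
    sym    : ∀ i j → adj i j ≡ adj j i
    irrefl : ∀ i → adj i i ≡ false

open Graph public

V : Graph → Set
V G = Fin (n G)

Adj : (G : Graph) → V G → V G → Set
Adj G u v = adj G u v ≡ true

record Path (G : Graph) : Set where
  field
    verts    : List (V G)
    distinct : Unique verts
    linked   : Linked (Adj G) verts

open Path public

data Consec {A : Set} (u v : A) : List A → Set where
  here  : ∀ {xs} → Consec u v (u ∷ v ∷ xs)
  there : ∀ {x xs} → Consec u v xs → Consec u v (x ∷ xs)

_∈V_ : {G : Graph} → V G → Path G → Set
v ∈V P = v LM.∈ verts P

EdgeIn : {G : Graph} → V G → V G → Path G → Set
EdgeIn u v P = Consec u v (verts P) ⊎ Consec v u (verts P)

IsSPath : {G : Graph} → Subset (n G) → Path G → Set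
IsSPath S P = ∀ v → v ∈ S → v ∈V P

IntDisjoint : {G : Graph} → Subset (n G) → Path G → Path G → Set
IntDisjoint S P P' =
  (∀ u v → EdgeIn u v P → ¬ EdgeIn u v P')
  × (∀ v → (v ∈V P × v ∈V P') → v ∈ S)
  × (∀ v → v ∈ S → (v ∈V P × v ∈V P'))

HasDisjointSPaths : (G : Graph) → Subset (n G) → ℕ → Set
HasDisjointSPaths G S m =
  Σ (Fin m → Path G) λ P →
    (∀ i → IsSPath S (P i)) ×
    (∀ i j → ¬ i ≡ j → IntDisjoint S (P i) (P j))

-- π_G(S) = p : p is the maximum number of pairwise internally disjoint
-- S-paths (the set of achievable numbers is downward closed).
LocalPathConn : (G : Graph) → Subset (n G) → ℕ → Set
LocalPathConn G S p = HasDisjointSPaths G S p × ¬ HasDisjointSPaths G S (ℕ.suc p)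

-- π_k(G) = p : 2 ≤ k ≤ |V(G)|, and p is the minimum of π_G(S) over all
-- k-subsets S (every k-subset admits p disjoint S-paths, i.e. π_G(S) ≥ p,
-- and some k-subset has π_G(S) = p).
PathConn : ℕ → Graph → ℕ → Set
PathConn k G p =
  2 ≤ k × k ≤ n G
  × (∀ (S : Subset (n G)) → ∣ S ∣ ≡ k → HasDisjointSPaths G S p)
  × (∃ λ (S : Subset (n G)) → ∣ S ∣ ≡ k × LocalPathConn G S p)

eqb : ∀ {m} → Fin m → Fin m → Bool
eqb i j = ⌊ i ≟ j ⌋

edgeList : (G : Graph) → List (V G × V G)
edgeList G = filter (λ e → proj₁ e <? proj₂ e ×-dec (adj G (proj₁ e) (proj₂ e) Data.Bool.≟ true))
                    (cartesianProduct (allFin (n G)) (allFin (n G)))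

shares : ∀ {m} → Fin m × Fin m → Fin m × Fin m → Bool
shares (i , j) (k , l) = eqb i k ∨ eqb i l ∨ eqb j k ∨ eqb j l

private
  eqb-sym : ∀ {m} (i j : Fin m) → eqb i j ≡ eqb j i
  eqb-sym i j with i ≟ j | j ≟ i
  ... | yes _ | yes _ = refl
  ... | no _ | no _ = refl
  ... | yes refl | no q with q refl
  ... | ()
  eqb-sym i j | no q | yes refl with q refl
  ... | ()

  eqb-refl : ∀ {m} (i : Fin m) → eqb i i ≡ true
  eqb-refl i with i ≟ i
  ... | yes _ = refl
  ... | no q with q refl
  ... | ()

  swap-mid : ∀ a b c d → a ∨ b ∨ c ∨ d ≡ a ∨ c ∨ b ∨ d
  swap-mid true b c d = refl
  swap-mid false true true d = refl
  swap-mid false true false d = refl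
  swap-mid false false true d = refl
  swap-mid false false false d = refl

  shares-sym : ∀ {m} (e f : Fin m × Fin m) → shares e f ≡ shares f e
  shares-sym (i , j) (k , l)
    rewrite eqb-sym k i | eqb-sym k j | eqb-sym l i | eqb-sym l j
    = swap-mid (eqb i k) (eqb i l) (eqb j k) (eqb j l)

  and-sym : ∀ {a b c d : Bool} → a ≡ b → c ≡ d → a ∧ c ≡ b ∧ d
  and-sym refl refl = refl

L : Graph → Graph
L G = record
  { n      = length (edgeList G)
  ; adj    = λ a b → not (eqb a b) ∧ shares (lookup (edgeList G) a) (lookup (edgeList G) b)
  ; sym    = λ a b → and-sym (cong not (eqb-sym a b))
                             (shares-sym (lookup (edgeList G) a) (lookup (edgeList G) b))
  ; irrefl = λ a → cong (λ x → not x ∧ shares (lookup (edgeList G) a) (lookup (edgeList G) a)) (eqb-refl a)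
  }

{-# OPTIONS --safe #-}

-- Take a huge clique and two further adjacent vertices u and v; join u to p − 1 clique vertices and
-- v to q − p + 1 others. A vertex of degree d in S lets at most d disjoint S-paths through, so u gives
-- π₃(G) ≤ p, and the edge uv, of degree q in L(G), gives π₃(L(G)) ≤ q. Conversely, any two clique
-- vertices of G, and any two edges of G other than uv, are joined by a path with two inner vertices
-- avoiding a prescribed small set, so the required paths can be built greedily from the neighbours
-- of u and v (respectively of uv). The tight case is S = {u, v, a}: there v needs p neighbours
-- besides u, which is the hypothesis q ≥ 2p − 1.
module Submission where

open import Defs
open import Data.Nat as ℕ using (ℕ; zero; suc; _≤_; _<_; _+_; _*_; _∸_; z≤n; s≤s; s≤s⁻¹)
open import Data.Nat.Properties as ℕ
  using (≤-refl; ≤-trans; ≤-reflexive; <⇒≱; m≤m+n; m≤n+m; m≤m*n; m≤n⇒m≤1+n; m≤n⇒m≤o+n;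
         +-mono-≤; +-monoˡ-≤; +-monoʳ-≤; *-monoˡ-≤; +-assoc; +-comm; +-suc; +-identityʳ; +-cancelˡ-≡)
open import Data.Bool using (true; false; not; _∧_; _∨_)
open import Data.Bool.Properties using (∨-zeroʳ)
open import Data.Fin as Fin using (Fin; zero; suc)
import Data.Fin.Properties as Fin
open import Data.Fin.Subset using (Subset; inside; outside; ∣_∣) renaming (_∈_ to _∈ˢ_; ⊥ to ∅)
open import Data.Fin.Subset.Properties using (∣⊥∣≡0; ∉⊥; ∣p∣≤n)
import Data.Vec as Vec
open import Data.List using (List; []; _∷_; length; _++_; map; lookup; tabulate; allFin; cartesianProduct)
open import Data.List.Properties using (length-++; length-map; length-tabulate)
open import Data.List.Membership.Propositional using (_∈_; _∉_)
open import Data.List.Membership.Propositional.Properties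
  using (∈-++⁺ˡ; ∈-++⁺ʳ; ∈-map⁺; ∈-map⁻; ∈-lookup; ∈-filter⁺; ∈-filter⁻; ∈-cartesianProduct⁺; ∈-allFin; ∈-tabulate⁺)
open import Data.List.Relation.Unary.Any using (here; there; index; any?)
open import Data.List.Relation.Unary.Any.Properties using (lookup-index)
open import Data.List.Relation.Unary.All as All using ([]; _∷_)
open import Data.List.Relation.Unary.All.Properties using (¬Any⇒All¬; All¬⇒¬Any)
open import Data.List.Relation.Unary.AllPairs using ([]; _∷_)
open import Data.List.Relation.Unary.Linked as Linked using (Linked; [-]; _∷_)
open import Data.List.Relation.Unary.Unique.Propositional using (Unique)
open import Data.List.Relation.Unary.Unique.Propositional.Properties as Unique using ()
open import Data.Product using (∃; ∃₂; _×_; _,_; proj₁; proj₂)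
open import Data.Sum using (_⊎_; inj₁; inj₂; [_,_]′)
open import Data.Empty using (⊥-elim) renaming (⊥ to Empty)
open import Data.Unit using (⊤; tt)
open import Function using (_∘_; id; mk⇔)
open import Relation.Nullary using (¬_; Dec; yes; no; does; ¬?; contradiction)
open import Relation.Nullary.Decidable using (_×-dec_; dec-true; dec-false; does-⇔; isYes≗does)
open import Relation.Binary.Definitions using (tri<; tri≈; tri>)
open import Relation.Binary.PropositionalEquality as ≡ using (_≡_; _≢_; refl; cong; subst; subst₂)

-- Enumerating subsets

-- Internal disjointness also forbids sharing an edge between two elements of `S`, and a neighbour
-- assigned to one path may itself lie in `S`. So two reserved vertices are never joined directly,
-- except along edges at `u` or `v` (in `L G`: at the edge uv) that are assigned to one path only;
-- every other connection goes through new vertices. These connections have two inner vertices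
-- because of `L G`: two edges without a common end have at most four common neighbours there,
-- whereas detours of two inner vertices are plentiful in a large clique. As each path has at most
-- nine vertices, the number of vertices that ever have to be avoided is bounded in advance by `q`,
-- and this fixes the size of the clique.

record Enumerates {m} (S : Subset m) (xs : List (Fin m)) : Set where
  field
    to   : ∀ {v} → v ∈ˢ S → v ∈ xs
    from : ∀ {v} → v ∈ xs → v ∈ˢ S
open Enumerates

enumerates-inside : ∀ {m} {S : Subset m} {xs} → Enumerates S xs → Enumerates (inside Vec.∷ S) (zero ∷ map suc xs)
enumerates-inside {S = S} {xs} E = record
  { to   = λ { Vec.here → here refl ; (Vec.there v∈) → there (∈-map⁺ suc (to E v∈)) }
  ; from = λ { (here refl) → Vec.here ; (there v∈) → lower (∈-map⁻ suc v∈) } }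
  where
  lower : ∀ {v} → (∃ λ w → w ∈ xs × v ≡ suc w) → v ∈ˢ (inside Vec.∷ S)
  lower (_ , w∈ , refl) = Vec.there (from E w∈)

enumerates-outside : ∀ {m} {S : Subset m} {xs} → Enumerates S xs → Enumerates (outside Vec.∷ S) (map suc xs)
enumerates-outside {S = S} {xs} E = record
  { to   = λ { (Vec.there v∈) → ∈-map⁺ suc (to E v∈) }
  ; from = λ v∈ → lower (∈-map⁻ suc v∈) }
  where
  lower : ∀ {v} → (∃ λ w → w ∈ xs × v ≡ suc w) → v ∈ˢ (outside Vec.∷ S)
  lower (_ , w∈ , refl) = Vec.there (from E w∈)

permute : ∀ {m} {S : Subset m} {xs ys} → (∀ {v} → v ∈ xs → v ∈ ys) → (∀ {v} → v ∈ ys → v ∈ xs) →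
  Enumerates S xs → Enumerates S ys
permute xs⊆ys ys⊆xs E = record { to = xs⊆ys ∘ to E ; from = from E ∘ ys⊆xs }

elements : ∀ {m} (S : Subset m) → ∃ λ xs → length xs ≡ ∣ S ∣ × Unique xs × Enumerates S xs
elements Vec.[] = [] , refl , [] , record { to = λ () ; from = λ () }
elements (inside Vec.∷ S) with elements S
... | xs , len , uniq , E = zero ∷ map suc xs , cong suc (≡.trans (length-map suc xs) len)
    , ¬Any⇒All¬ _ (λ 0∈ → absurd (∈-map⁻ suc 0∈)) ∷ Unique.map⁺ Fin.suc-injective uniq
    , enumerates-inside E
  where
  absurd : ¬ (∃ λ w → w ∈ xs × zero ≡ suc w)
  absurd (_ , _ , ())
elements (outside Vec.∷ S) with elements S
... | xs , len , uniq , E = map suc xs , ≡.trans (length-map suc xs) len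
    , Unique.map⁺ Fin.suc-injective uniq , enumerates-outside E

one-element : ∀ {m} (S : Subset m) → ∣ S ∣ ≡ 1 → ∃ λ a → Enumerates S (a ∷ [])
one-element S size with elements S
... | xs , len , _ , E with xs | ≡.trans len size | E
... | a ∷ [] | refl | E′ = a , E′

two-elements : ∀ {m} (S : Subset m) → ∣ S ∣ ≡ 2 → ∃₂ λ a b → a ≢ b × Enumerates S (a ∷ b ∷ [])
two-elements S size with elements S
... | xs , len , uniq , E with xs | ≡.trans len size | uniq | E
... | a ∷ b ∷ [] | refl | (a≢b ∷ _) ∷ _ | E′ = a , b , a≢b , E′

three-elements : ∀ {m} (S : Subset m) → ∣ S ∣ ≡ 3 →
  ∃₂ λ a b → ∃ λ c → a ≢ b × a ≢ c × b ≢ c × Enumerates S (a ∷ b ∷ c ∷ [])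
three-elements S size with elements S
... | xs , len , uniq , E with xs | ≡.trans len size | uniq | E
... | a ∷ b ∷ c ∷ [] | refl | (a≢b ∷ a≢c ∷ _) ∷ (b≢c ∷ _) ∷ _ | E′ = a , b , c , a≢b , a≢c , b≢c , E′

insert : ∀ {m} → Fin m → Subset m → Subset m
insert x S = S Vec.[ x ]≔ inside

∈-insert : ∀ {m} (x : Fin m) S → x ∈ˢ insert x S
∈-insert zero    (_ Vec.∷ _) = Vec.here
∈-insert (suc x) (_ Vec.∷ S) = Vec.there (∈-insert x S)

∣insert∣ : ∀ {m} (x : Fin m) S → ¬ (x ∈ˢ S) → ∣ insert x S ∣ ≡ suc ∣ S ∣
∣insert∣ zero    (inside Vec.∷ S) x∉ = contradiction Vec.here x∉
∣insert∣ zero    (outside Vec.∷ S) x∉ = refl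
∣insert∣ (suc x) (inside Vec.∷ S) x∉ = cong suc (∣insert∣ x S (x∉ ∘ Vec.there))
∣insert∣ (suc x) (outside Vec.∷ S) x∉ = ∣insert∣ x S (x∉ ∘ Vec.there)

∈-insert⁻ : ∀ {m} {v} (x : Fin m) S → v ∈ˢ insert x S → v ≡ x ⊎ v ∈ˢ S
∈-insert⁻ zero    (_ Vec.∷ S) Vec.here = inj₁ refl
∈-insert⁻ zero    (_ Vec.∷ S) (Vec.there v∈) = inj₂ (Vec.there v∈)
∈-insert⁻ (suc x) (_ Vec.∷ S) Vec.here = inj₂ Vec.here
∈-insert⁻ (suc x) (_ Vec.∷ S) (Vec.there v∈) with ∈-insert⁻ x S v∈
... | inj₁ refl = inj₁ refl
... | inj₂ v∈′ = inj₂ (Vec.there v∈′)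

∈-insert⁺ : ∀ {m} {v : Fin m} x S → v ∈ˢ S → v ∈ˢ insert x S
∈-insert⁺ zero    (_ Vec.∷ _) Vec.here = Vec.here
∈-insert⁺ zero    (_ Vec.∷ _) (Vec.there v∈) = Vec.there v∈
∈-insert⁺ (suc x) (_ Vec.∷ _) Vec.here = Vec.here
∈-insert⁺ (suc x) (_ Vec.∷ S) (Vec.there v∈) = Vec.there (∈-insert⁺ x S v∈)

fromUnique : ∀ {m} (xs : List (Fin m)) → Unique xs → ∃ λ S → ∣ S ∣ ≡ length xs × Enumerates S xs
fromUnique {m} [] [] = ∅ , ∣⊥∣≡0 m , record { to = λ v∈ → ⊥-elim (∉⊥ v∈) ; from = λ () }
fromUnique (x ∷ xs) (x∉ ∷ uniq) with fromUnique xs uniq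
... | S , size , E = insert x S
    , ≡.trans (∣insert∣ x S (λ x∈ → All.lookup x∉ (to E x∈) refl)) (cong suc size)
    , record { to   = λ v∈ → [ here , there ∘ to E ]′ (∈-insert⁻ x S v∈)
             ; from = λ { (here refl) → ∈-insert x S ; (there v∈) → ∈-insert⁺ x S (from E v∈) } }

-- If `X` contained every value of `g`, sending an index to the position of its value would map
-- `Fin k` into fewer places, and a collision would contradict injectivity.
fresh : ∀ {m k} (g : Fin k → Fin m) → (∀ {i j} → g i ≡ g j → i ≡ j) →
  ∀ X → length X < k → ∃ λ i → g i ∉ X
fresh {k = k} g g-inj X X<k = Fin.¬∀⟶∃¬ k (λ i → g i ∈ X) (λ i → any? (g i Fin.≟_) X) all-used
  where
  all-used : ¬ (∀ i → g i ∈ X)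
  all-used g∈ with Fin.pigeonhole X<k (index ∘ g∈)
  ... | i , j , i<j , eq = Fin.<⇒≢ i<j (g-inj
          (≡.trans (lookup-index (g∈ i)) (≡.trans (cong (lookup X) eq) (≡.sym (lookup-index (g∈ j))))))

lookup-injective : ∀ {A : Set} {xs : List A} → Unique xs → ∀ {i j} → lookup xs i ≡ lookup xs j → i ≡ j
lookup-injective {xs = _ ∷ _} _          {zero}  {zero}  _  = refl
lookup-injective {xs = _ ∷ _} (x≢ ∷ _)   {zero}  {suc j} eq = contradiction eq (All.lookup x≢ (∈-lookup j))
lookup-injective {xs = _ ∷ _} (x≢ ∷ _)   {suc i} {zero}  eq = contradiction (≡.sym eq) (All.lookup x≢ (∈-lookup i))
lookup-injective {xs = _ ∷ _} (_ ∷ uniq) {suc i} {suc j} eq = cong suc (lookup-injective uniq eq)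

-- Membership and consecutive entries in lists

module _ {A : Set} where

  -- In the trails below, `b` is the reserved neighbour visited right after `a`; inserting it must
  -- not lose any element of `S`.
  insert-second : ∀ {a b w : A} {xs} → w ∈ a ∷ xs → w ∈ a ∷ b ∷ xs
  insert-second (here eq)  = here eq
  insert-second (there w∈) = there (there w∈)

  exchange : ∀ {a b w : A} {xs} → w ∈ a ∷ b ∷ xs → w ∈ b ∷ a ∷ xs
  exchange (here eq)          = there (here eq)
  exchange (there (here eq))  = here eq
  exchange (there (there w∈)) = there (there w∈)

  rotate : ∀ {a b c w : A} → w ∈ a ∷ b ∷ c ∷ [] → w ∈ c ∷ a ∷ b ∷ []
  rotate (here eq)                 = there (here eq)
  rotate (there (here eq))         = there (there (here eq))
  rotate (there (there (here eq))) = here eq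

  Linked⇒Consec : ∀ {R : A → A → Set} {x y xs} → Linked R xs → Consec x y xs → R x y
  Linked⇒Consec (r ∷ _)  here      = r
  Linked⇒Consec (_ ∷ rs) (there c) = Linked⇒Consec rs c
  Linked⇒Consec [-] (there ())

  Consec⇒∈ˡ : ∀ {x y : A} {xs} → Consec x y xs → x ∈ xs
  Consec⇒∈ˡ here      = here refl
  Consec⇒∈ˡ (there c) = there (Consec⇒∈ˡ c)

  Consec⇒∈ʳ : ∀ {x y : A} {xs} → Consec x y xs → y ∈ xs
  Consec⇒∈ʳ here      = there (here refl)
  Consec⇒∈ʳ (there c) = there (Consec⇒∈ʳ c)

  endˡ : ∀ {x y : A} {xs} → Consec x y xs ⊎ Consec y x xs → x ∈ xs
  endˡ = [ Consec⇒∈ˡ , Consec⇒∈ʳ ]′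

  endʳ : ∀ {x y : A} {xs} → Consec x y xs ⊎ Consec y x xs → y ∈ xs
  endʳ = [ Consec⇒∈ʳ , Consec⇒∈ˡ ]′

  predecessor : ∀ {x z : A} {xs} → x ∈ xs → ∃ λ w → Consec w x (z ∷ xs)
  predecessor (here refl) = _ , here
  predecessor (there x∈)  = _ , there (proj₂ (predecessor x∈))

  -- An entry that is not first has a predecessor; a first entry has a successor because `y` must
  -- occur further on.
  neighbour : ∀ {x y : A} {xs} → x ∈ xs → y ∈ xs → x ≢ y → ∃ λ w → Consec x w xs ⊎ Consec w x xs
  neighbour (there x∈)  _           _   = _ , inj₂ (proj₂ (predecessor x∈))
  neighbour (here refl) (here refl) x≢y = contradiction refl x≢y
  neighbour {xs = _ ∷ _ ∷ _} (here refl) (there _) _ = _ , inj₁ here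

-- The upper bound by degree

other-member : ∀ {m} (S : Subset m) x → 2 ≤ ∣ S ∣ → ∃ λ y → y ∈ˢ S × x ≢ y
other-member S x 2≤ with elements S
... | [] , len , _ = contradiction (subst (2 ≤_) (≡.sym len) 2≤) λ ()
... | _ ∷ [] , len , _ = contradiction (subst (2 ≤_) (≡.sym len) 2≤) λ { (s≤s ()) }
... | a ∷ b ∷ _ , _ , (a≢b ∷ _) ∷ _ , E with x Fin.≟ a
... | yes refl = b , from E (there (here refl)) , a≢b
... | no x≢a = a , from E (here refl) , x≢a

-- Distinct S-paths use distinct edges at s.
degree-bound : ∀ H (S : Subset (n H)) {d s} (nb : Fin d → V H) →
  (∀ {w} → Adj H s w → ∃ λ i → w ≡ nb i) →
  s ∈ˢ S → 2 ≤ ∣ S ∣ → ¬ HasDisjointSPaths H S (suc d)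
degree-bound H S {d} {s} nb onto s∈S 2≤ (P , spath , disjoint) = go (Fin.pigeonhole ≤-refl (proj₁ ∘ exit))
  where
  exit : ∀ i → ∃ λ k → EdgeIn s (nb k) (P i)
  -- A second element of `S` is essential: a path consisting of `s` alone would use no edge at `s`.
  exit i with other-member S s 2≤
  ... | y , y∈S , s≢y with neighbour (spath i s s∈S) (spath i y y∈S) s≢y
  ... | w , inj₁ c with onto (Linked⇒Consec (linked (P i)) c)
  ... | k , refl = k , inj₁ c
  exit i | y , y∈S , s≢y | w , inj₂ c with onto (≡.trans (Graph.sym H s w) (Linked⇒Consec (linked (P i)) c))
  ... | k , refl = k , inj₂ c
  go : ¬ (∃₂ λ i j → i Fin.< j × proj₁ (exit i) ≡ proj₁ (exit j))
  go (i , j , i<j , eq) = proj₁ (disjoint i j (Fin.<⇒≢ i<j)) s (nb (proj₁ (exit i)))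
    (proj₂ (exit i)) (subst (λ k → EdgeIn s (nb k) (P j)) (≡.sym eq) (proj₂ (exit j)))

-- Greedy construction of disjoint paths

-- A trail is a path starting at t and made of vertices reserved in F (those of W) together with
-- fresh ones, whose edges between reserved vertices satisfy T.
module Trails (H : Graph) (K : V H → Set) (B : ℕ)
  (bridge : ∀ F → length F ≤ B + 10 → ∀ {x y} → K x → K y → x ∈ F → y ∈ F →
    ∃₂ λ w w′ → w ∉ F × w′ ∉ F × w ≢ w′ × Adj H x w × Adj H w w′ × Adj H w′ y)
  where

  module _ (T : V H → V H → Set) (F : List (V H)) where

    Step : V H → V H → Set
    Step x y = Adj H x y × (x ∈ F → y ∈ F → T x y)

    record Trail (W : List (V H)) (ℓ : ℕ) (t : V H) : Set where
      field
        rest   : List (V H)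
        unique : Unique (t ∷ rest)
        steps  : Linked Step (t ∷ rest)
        within : ∀ {v} → v ∈ t ∷ rest → v ∈ W ⊎ v ∉ F
        covers : ∀ {v} → v ∈ W → v ∈ t ∷ rest
        short  : length (t ∷ rest) ≤ ℓ

  module _ {T : V H → V H → Set} {F : List (V H)} where
    open Trail

    relax : ∀ {W W′ ℓ ℓ′ t} → (∀ {v} → v ∈ W → v ∈ W′) → (∀ {v} → v ∈ W′ → v ∈ W) → ℓ ≤ ℓ′ →
      Trail T F W ℓ t → Trail T F W′ ℓ′ t
    relax to from ℓ≤ p = record
      { rest = rest p ; unique = unique p ; steps = steps p
      ; within = [ inj₁ ∘ to , inj₂ ]′ ∘ within p
      ; covers = covers p ∘ from
      ; short = ≤-trans (short p) ℓ≤ }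

    single : ∀ t → Trail T F (t ∷ []) 1 t
    single t = record
      { rest = [] ; unique = [] ∷ [] ; steps = [-] ; within = inj₁ ; covers = id ; short = ≤-refl }

    avoids : ∀ {W ℓ t x} (p : Trail T F W ℓ t) → x ∈ F → x ∉ W → x ∉ t ∷ rest p
    avoids p x∈F x∉W x∈p = [ x∉W , (λ x∉F → x∉F x∈F) ]′ (within p x∈p)

    cons : ∀ {W ℓ t x} → x ∈ F → x ∉ W → Adj H x t → T x t →
      Trail T F W ℓ t → Trail T F (x ∷ W) (suc ℓ) x
    cons {t = t} x∈F x∉W adj Txt p = record
      { rest = t ∷ rest p
      ; unique = ¬Any⇒All¬ _ (avoids p x∈F x∉W) ∷ unique p
      ; steps = (adj , λ _ _ → Txt) ∷ steps p
      ; within = λ { (here eq) → inj₁ (here eq) ; (there v∈) → [ inj₁ ∘ there , inj₂ ]′ (within p v∈) }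
      ; covers = λ { (here eq) → here eq ; (there v∈) → there (covers p v∈) }
      ; short = s≤s (short p) }

    join : length F ≤ B → ∀ {W ℓ t x} → ℓ ≤ 10 → K x → K t → x ∈ F → x ∉ W →
      Trail T F W ℓ t → Trail T F (x ∷ W) (3 + ℓ) x
    join F≤B {t = t} {x} ℓ≤10 Kx Kt x∈F x∉W p
      -- The current trail is avoided along with `F`, so the two inner vertices repeat nothing; this
      -- is where the extra 10 in `bridge` goes. Since `x` and `t` are in the avoided list, the
      -- inner vertices also differ from them.
      with bridge ((t ∷ rest p) ++ F)
        (≤-trans (≤-reflexive (length-++ (t ∷ rest p)))
          (≤-trans (+-mono-≤ (≤-trans (short p) ℓ≤10) F≤B) (≤-reflexive (+-comm 10 B))))
        Kx Kt (∈-++⁺ʳ _ x∈F) (here refl)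
    ... | w , w′ , w∉ , w′∉ , w≢w′ , xw , ww′ , w′t = record
      { rest = w ∷ w′ ∷ t ∷ rest p
      ; unique =
          ¬Any⇒All¬ _ (λ { (here refl) → w∉F x∈F ; (there (here refl)) → w′∉F x∈F
                         ; (there (there x∈p)) → avoids p x∈F x∉W x∈p })
        ∷ ¬Any⇒All¬ _ (λ { (here w≡w′) → w≢w′ w≡w′ ; (there w∈p) → w∉ (∈-++⁺ˡ w∈p) })
        ∷ ¬Any⇒All¬ _ (w′∉ ∘ ∈-++⁺ˡ)
        ∷ unique p
      ; steps = (xw , λ _ w∈ → ⊥-elim (w∉F w∈)) ∷ (ww′ , λ w∈ _ → ⊥-elim (w∉F w∈))
              ∷ (w′t , λ w′∈ _ → ⊥-elim (w′∉F w′∈)) ∷ steps p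
      ; within = λ { (here eq) → inj₁ (here eq) ; (there (here refl)) → inj₂ w∉F
                   ; (there (there (here refl))) → inj₂ w′∉F
                   ; (there (there (there v∈))) → [ inj₁ ∘ there , inj₂ ]′ (within p v∈) }
      ; covers = λ { (here eq) → here eq ; (there v∈) → there (there (there (covers p v∈))) }
      ; short = s≤s (s≤s (s≤s (short p))) }
      where
      w∉F : w ∉ F
      w∉F = w∉ ∘ ∈-++⁺ʳ _
      w′∉F : w′ ∉ F
      w′∉F = w′∉ ∘ ∈-++⁺ʳ _

    -- An assigned neighbour may happen to be the element of `S` at which the trail begins. Then
    -- nothing is added, and `x` merely occurs twice in `x ∷ W`, which matters only as a set.
    meet : length F ≤ B → ∀ {W ℓ t x} → ℓ ≤ 10 → K x → K t → x ∈ F → x ≡ t ⊎ x ∉ W →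
      Trail T F W ℓ t → Trail T F (x ∷ W) (3 + ℓ) x
    meet F≤B ℓ≤ Kx Kt x∈F (inj₂ x∉W) p = join F≤B ℓ≤ Kx Kt x∈F x∉W p
    meet F≤B {ℓ = ℓ} ℓ≤ Kx Kt x∈F (inj₁ refl) p = record
      { rest = rest p ; unique = unique p ; steps = steps p
      ; within = [ inj₁ ∘ there , inj₂ ]′ ∘ within p
      ; covers = λ { (here eq) → here eq ; (there v∈) → covers p v∈ }
      ; short = ≤-trans (short p) (m≤n+m ℓ 3) }

    triple : length F ≤ B → ∀ {a b c} → K a → K b → K c → a ∈ F → b ∈ F → c ∈ F →
      a ≢ b → a ≢ c → b ≢ c → Trail T F (a ∷ b ∷ c ∷ []) 7 a
    triple F≤B Ka Kb Kc a∈ b∈ c∈ a≢b a≢c b≢c =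
      join F≤B (s≤s (s≤s (s≤s (s≤s z≤n)))) Ka Kb a∈ (All¬⇒¬Any (a≢b ∷ a≢c ∷ []))
        (join F≤B (s≤s z≤n) Kb Kc b∈ (All¬⇒¬Any (b≢c ∷ [])) (single _))

    -- If t is c, the trail has to visit c before b.
    fan : length F ≤ B → ∀ {t b c} → K t → K b → K c → t ∈ F → b ∈ F → c ∈ F → b ≢ c →
      Trail T F (t ∷ b ∷ c ∷ []) 7 t
    fan F≤B {t} {b} {c} Kt Kb Kc t∈ b∈ c∈ b≢c with t Fin.≟ c
    ... | yes refl = relax (λ { (here eq) → here eq ; (there v∈) → there (here-only v∈) })
                           (λ { (here eq) → here eq ; (there (here eq)) → there (here eq) ; (there (there (here eq))) → here eq })
                           (m≤m+n 4 3)
                           (join F≤B (s≤s z≤n) Kc Kb c∈ (λ { (here c≡b) → b≢c (≡.sym c≡b) }) (single b))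
      where
      here-only : ∀ {v} → v ∈ b ∷ [] → v ∈ b ∷ t ∷ []
      here-only (here eq) = here eq
    ... | no t≢c = meet F≤B (s≤s (s≤s (s≤s (s≤s z≤n)))) Kt Kb t∈ t-position
                     (join F≤B (s≤s z≤n) Kb Kc b∈ (λ { (here b≡c) → b≢c b≡c }) (single c))
      where
      t-position : t ≡ b ⊎ t ∉ b ∷ c ∷ []
      t-position with t Fin.≟ b
      ... | yes t≡b = inj₁ t≡b
      ... | no t≢b = inj₂ λ { (here eq) → t≢b eq ; (there (here eq)) → t≢c eq }

  -- The i-th path may use the reserved vertices A i and, between reserved vertices, the edges T i.
  -- The reserved set F grows during the construction, as it absorbs the paths already built.
  Family : ∀ {m} → Subset (n H) → (Fin m → V H → Set) → (Fin m → V H → V H → Set) → List (V H) → Set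
  Family S A T F₀ = ∀ i F → length F ≤ B → (∀ {v} → v ∈ F₀ → v ∈ F) →
    ∃₂ λ W t → Trail (T i) F W 9 t × (∀ {v} → v ∈ W → A i v) × (∀ {v} → v ∈ˢ S → v ∈ W)

  -- These properties pass from a longer list `F` to any sublist, so a path built after `F` has
  -- grown still fits the original list.
  record Fits (S : Subset (n H)) (A : V H → Set) (T : V H → V H → Set) (F : List (V H)) (P : Path H) : Set where
    field
      spath  : IsSPath S P
      within : ∀ {v} → v ∈V P → A v ⊎ v ∉ F
      edges  : ∀ {x y} → Consec x y (verts P) → x ∈ F → y ∈ F → T x y
  open Fits

  -- Each path spends at most 9 of the allowance `B`, and its vertices join the reserved list. A
  -- later path can therefore meet it only where its own `A` allows; without knowing which of the
  -- two came first, this is a disjunction.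
  greedy : ∀ {m} S (A : Fin m → V H → Set) (T : Fin m → V H → V H → Set) F → length F + m * 9 ≤ B →
    Family S A T F →
    ∃ λ (P : Fin m → Path H) → (∀ i → Fits S (A i) (T i) F (P i))
          × (∀ i j → i ≢ j → ∀ {v} → v ∈V P i → v ∈V P j → A i v ⊎ A j v)
  greedy {zero} S A T F F≤ build = (λ ()) , (λ ()) , λ ()
  greedy {suc m} S A T F F≤ build with build zero F (≤-trans (m≤m+n _ _) F≤) id
  ... | W , t , p , W⊆A , S⊆W
      with greedy S (A ∘ suc) (T ∘ suc) ((t ∷ Trail.rest p) ++ F) F′≤
             (λ i F′ F′≤B F⊆F′ → build (suc i) F′ F′≤B (F⊆F′ ∘ ∈-++⁺ʳ _))
    where
    F′≤ : length ((t ∷ Trail.rest p) ++ F) + m * 9 ≤ B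
    F′≤ = ≤-trans (+-monoˡ-≤ (m * 9)
              (≤-trans (≤-reflexive (length-++ (t ∷ Trail.rest p)))
                (≤-trans (+-monoˡ-≤ (length F) (Trail.short p)) (≤-reflexive (+-comm 9 (length F))))))
            (≤-trans (≤-reflexive (+-assoc (length F) 9 (m * 9))) F≤)
  ... | P , fits , sep = P′ , fits′ , sep′
    where
    P₀ : Path H
    P₀ = record { verts = t ∷ Trail.rest p ; distinct = Trail.unique p
                ; linked = Linked.map proj₁ (Trail.steps p) }
    P′ : Fin (suc m) → Path H
    P′ zero    = P₀
    P′ (suc i) = P i
    fits′ : ∀ i → Fits S (A i) (T i) F (P′ i)
    fits′ zero = record
      { spath = λ v v∈ → Trail.covers p (S⊆W v∈)
      ; within = [ inj₁ ∘ W⊆A , inj₂ ]′ ∘ Trail.within p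
      ; edges = λ c → proj₂ (Linked⇒Consec (Trail.steps p) c) }
    fits′ (suc i) = record
      { spath = spath (fits i)
      ; within = [ inj₁ , (λ v∉ → inj₂ (v∉ ∘ ∈-++⁺ʳ _)) ]′ ∘ within (fits i)
      ; edges = λ c x∈ y∈ → edges (fits i) c (∈-++⁺ʳ _ x∈) (∈-++⁺ʳ _ y∈) }
    reserved : ∀ j {v} → v ∈V P₀ → v ∈V P j → A (suc j) v
    reserved j v∈₀ v∈ = [ id , (λ v∉ → contradiction (∈-++⁺ˡ v∈₀) v∉) ]′ (within (fits j) v∈)
    sep′ : ∀ i j → i ≢ j → ∀ {v} → v ∈V P′ i → v ∈V P′ j → A i v ⊎ A j v
    sep′ zero zero i≢j = contradiction refl i≢j
    sep′ zero (suc j) _ v∈ v∈′ = inj₂ (reserved j v∈ v∈′)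
    sep′ (suc i) zero _ v∈ v∈′ = inj₁ (reserved i v∈′ v∈)
    sep′ (suc i) (suc j) i≢j = sep i j (i≢j ∘ cong suc)

  -- By `greedy`, a common vertex is allowed to one of the two paths, hence lies in `F`, hence is
  -- allowed to the other as well, and so belongs to `S`. A common edge then has both ends in `S`,
  -- hence in `F`, so it would satisfy both `T i` and `T j`.
  disjoint-paths : ∀ {m} S (A : Fin m → V H → Set) (T : Fin m → V H → V H → Set) F →
    length F + m * 9 ≤ B → Family S A T F →
    (∀ {v} → v ∈ˢ S → v ∈ F) → (∀ i {v} → A i v → v ∈ F) →
    (∀ i j → i ≢ j → ∀ {v} → A i v → A j v → v ∈ˢ S) →
    (∀ i {x y} → T i x y → T i y x) → (∀ i j → i ≢ j → ∀ {x y} → T i x y → ¬ T j x y) →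
    HasDisjointSPaths H S m
  disjoint-paths S A T F F≤ build S⊆F A⊆F A-disj T-sym T-disj with greedy S A T F F≤ build
  ... | P , fits , sep = P , (λ i → spath (fits i)) , λ i j i≢j →
        (λ x y e e′ → T-disj i j i≢j (edge i e (common i≢j (endˡ e) (endˡ e′)) (common i≢j (endʳ e) (endʳ e′)))
                                     (edge j e′ (common i≢j (endˡ e) (endˡ e′)) (common i≢j (endʳ e) (endʳ e′))))
      , (λ v (v∈ , v∈′) → common i≢j v∈ v∈′)
      , λ v v∈ → spath (fits i) v v∈ , spath (fits j) v v∈
    where
    allowed : ∀ i {v} → v ∈V P i → v ∈ F → A i v
    allowed i v∈ v∈F = [ id , (λ v∉ → contradiction v∈F v∉) ]′ (within (fits i) v∈)
    common : ∀ {i j} → i ≢ j → ∀ {v} → v ∈V P i → v ∈V P j → v ∈ˢ S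
    common {i} {j} i≢j v∈ v∈′ with sep i j i≢j v∈ v∈′
    ... | inj₁ Av = A-disj i j i≢j Av (allowed j v∈′ (A⊆F i Av))
    ... | inj₂ Av = A-disj i j i≢j (allowed i v∈ (A⊆F j Av)) Av
    edge : ∀ i {x y} → EdgeIn x y (P i) → x ∈ˢ S → y ∈ˢ S → T i x y
    edge i (inj₁ c) x∈ y∈ = edges (fits i) c (S⊆F x∈) (S⊆F y∈)
    edge i (inj₂ c) x∈ y∈ = T-sym i (edges (fits i) c (S⊆F y∈) (S⊆F x∈))

-- Line graphs

eqb-true : ∀ {m} {i j : Fin m} → i ≡ j → eqb i j ≡ true
eqb-true {i = i} {j} eq = ≡.trans (isYes≗does (i Fin.≟ j)) (dec-true (i Fin.≟ j) eq)

eqb-false : ∀ {m} {i j : Fin m} → i ≢ j → eqb i j ≡ false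
eqb-false {i = i} {j} i≢j = ≡.trans (isYes≗does (i Fin.≟ j)) (dec-false (i Fin.≟ j) i≢j)

shares-true : ∀ {m} {x : Fin m} e f → x ≡ proj₁ e ⊎ x ≡ proj₂ e → x ≡ proj₁ f ⊎ x ≡ proj₂ f → shares e f ≡ true
shares-true (i , j) (k , l) (inj₁ refl) (inj₁ refl) rewrite eqb-true {i = i} refl = refl
shares-true (i , j) (k , l) (inj₁ refl) (inj₂ refl) rewrite eqb-true {i = i} refl = ∨-zeroʳ _
shares-true (i , j) (k , l) (inj₂ refl) (inj₁ refl) rewrite eqb-true {i = j} refl
  = ≡.trans (cong (eqb i j ∨_) (∨-zeroʳ (eqb i l))) (∨-zeroʳ (eqb i j))
shares-true (i , j) (k , l) (inj₂ refl) (inj₂ refl) rewrite eqb-true {i = j} refl | ∨-zeroʳ (eqb j k)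
  = ≡.trans (cong (eqb i k ∨_) (∨-zeroʳ (eqb i j))) (∨-zeroʳ (eqb i k))

shares-true⁻ : ∀ {m} (e f : Fin m × Fin m) → shares e f ≡ true →
  ∃ λ x → (x ≡ proj₁ e ⊎ x ≡ proj₂ e) × (x ≡ proj₁ f ⊎ x ≡ proj₂ f)
shares-true⁻ (i , j) (k , l) eq with i Fin.≟ k
... | yes p = _ , inj₁ refl , inj₁ p
... | no _ with i Fin.≟ l
... | yes p = _ , inj₁ refl , inj₂ p
... | no _ with j Fin.≟ k
... | yes p = _ , inj₂ refl , inj₁ p
... | no _ with j Fin.≟ l
... | yes p = _ , inj₂ refl , inj₂ p
... | no _ with () ← eq

module LineGraph (G : Graph) where

  ends : V (L G) → V G × V G
  ends = lookup (edgeList G)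

  private
    edge? : (e : V G × V G) → Dec (proj₁ e Fin.< proj₂ e × Adj G (proj₁ e) (proj₂ e))
    edge? e = proj₁ e Fin.<? proj₂ e ×-dec (adj G (proj₁ e) (proj₂ e) Data.Bool.≟ true)

  ends-edge : ∀ a → proj₁ (ends a) Fin.< proj₂ (ends a) × Adj G (proj₁ (ends a)) (proj₂ (ends a))
  ends-edge a = proj₂ (∈-filter⁻ edge? {xs = cartesianProduct (allFin (n G)) (allFin (n G))}
                         (∈-lookup {xs = edgeList G} a))

  ends-injective : ∀ {a b} → ends a ≡ ends b → a ≡ b
  ends-injective = lookup-injective
    (Unique.filter⁺ edge? (Unique.cartesianProduct⁺ (Unique.allFin⁺ (n G)) (Unique.allFin⁺ (n G))))

  -- The edge list stores each edge once, smaller end first; this relation forgets that orientation.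
  data Joins (x y : V G) (a : V (L G)) : Set where
    forth : ends a ≡ (x , y) → Joins x y a
    back  : ends a ≡ (y , x) → Joins x y a

  data Inc (x : V G) (a : V (L G)) : Set where
    fst : x ≡ proj₁ (ends a) → Inc x a
    snd : x ≡ proj₂ (ends a) → Inc x a

  Joins⇒Incˡ : ∀ {x y a} → Joins x y a → Inc x a
  Joins⇒Incˡ (forth eq) = fst (≡.sym (cong proj₁ eq))
  Joins⇒Incˡ (back eq)  = snd (≡.sym (cong proj₂ eq))

  Joins⇒Incʳ : ∀ {x y a} → Joins x y a → Inc y a
  Joins⇒Incʳ (forth eq) = snd (≡.sym (cong proj₂ eq))
  Joins⇒Incʳ (back eq)  = fst (≡.sym (cong proj₁ eq))

  Inc-Joins : ∀ {x y z a} → Joins x y a → Inc z a → z ≡ x ⊎ z ≡ y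
  Inc-Joins (forth eq) (fst refl) = inj₁ (cong proj₁ eq)
  Inc-Joins (forth eq) (snd refl) = inj₂ (cong proj₂ eq)
  Inc-Joins (back eq)  (fst refl) = inj₂ (cong proj₁ eq)
  Inc-Joins (back eq)  (snd refl) = inj₁ (cong proj₂ eq)

  Inc⇒Joins : ∀ {x y a} → x ≢ y → Inc x a → Inc y a → Joins x y a
  Inc⇒Joins x≢y (fst refl) (fst refl) = contradiction refl x≢y
  Inc⇒Joins x≢y (fst refl) (snd refl) = forth refl
  Inc⇒Joins x≢y (snd refl) (fst refl) = back refl
  Inc⇒Joins x≢y (snd refl) (snd refl) = contradiction refl x≢y

  Joins⇒Adj : ∀ {x y a} → Joins x y a → Adj G x y
  Joins⇒Adj {a = a} (forth refl) = proj₂ (ends-edge a)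
  Joins⇒Adj {x} {y} {a} (back refl) = ≡.trans (Graph.sym G x y) (proj₂ (ends-edge a))

  private
    not-both-ways : ∀ {x y a b} → ends a ≡ (x , y) → ends b ≢ (y , x)
    not-both-ways {a = a} {b} eq eq′ = Fin.<-asym
      (subst₂ Fin._<_ (cong proj₁ eq) (cong proj₂ eq) (proj₁ (ends-edge a)))
      (subst₂ Fin._<_ (cong proj₁ eq′) (cong proj₂ eq′) (proj₁ (ends-edge b)))

  -- With equal orientations this is the absence of repetitions in the edge list. Opposite
  -- orientations cannot both occur, since stored pairs are increasing.
  Joins-unique : ∀ {x y a b} → Joins x y a → Joins x y b → a ≡ b
  Joins-unique (forth eq) (forth eq′) = ends-injective (≡.trans eq (≡.sym eq′))
  Joins-unique (back eq)  (back eq′)  = ends-injective (≡.trans eq (≡.sym eq′))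
  Joins-unique {a = a} {b} (forth eq) (back eq′) = contradiction eq′ (not-both-ways {a = a} {b} eq)
  Joins-unique {a = a} {b} (back eq) (forth eq′) = contradiction eq (not-both-ways {a = b} {a} eq′)

  private
    ordered-edge : ∀ {x y} → x Fin.< y → Adj G x y → ∃ λ a → ends a ≡ (x , y)
    ordered-edge x<y xy = index xy∈ , ≡.sym (lookup-index xy∈)
      where xy∈ = ∈-filter⁺ edge? (∈-cartesianProduct⁺ (∈-allFin _) (∈-allFin _)) (x<y , xy)

  abstract
    -- Abstract, since the position of an edge in the list never matters: later arguments use only
    -- its `Joins` property.
    edge : ∀ {x y} → Adj G x y → ∃ (Joins x y)
    edge {x} {y} xy with Fin.<-cmp x y
    ... | tri< x<y _ _ = let a , eq = ordered-edge x<y xy in a , forth eq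
    ... | tri> _ _ y<x = let a , eq = ordered-edge y<x (≡.trans (Graph.sym G y x) xy) in a , back eq
    ... | tri≈ _ refl _ with () ← ≡.trans (≡.sym xy) (irrefl G x)

  meet⇒Adj : ∀ {x a b} → a ≢ b → Inc x a → Inc x b → Adj (L G) a b
  meet⇒Adj {a = a} {b} a≢b xa xb =
    ≡.cong₂ (λ c d → not c ∧ d) (eqb-false a≢b) (shares-true (ends a) (ends b) (either xa) (either xb))
    where
    either : ∀ {x a} → Inc x a → x ≡ proj₁ (ends a) ⊎ x ≡ proj₂ (ends a)
    either (fst eq) = inj₁ eq
    either (snd eq) = inj₂ eq

  Adj⇒meet : ∀ {a b} → Adj (L G) a b → a ≢ b × ∃ λ x → Inc x a × Inc x b
  Adj⇒meet {a} {b} ab = a≢b , (let x , xa , xb = shares-true⁻ (ends a) (ends b) (second ab) in x , [ fst , snd ]′ xa , [ fst , snd ]′ xb)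
    where
    a≢b : a ≢ b
    a≢b refl with () ← ≡.trans (≡.sym ab) (irrefl (L G) a)
    second : ∀ {c d} → not c ∧ d ≡ true → d ≡ true
    second {false} eq = eq

  -- An edge with an end outside this list is not in `F`, so avoiding edges reduces to avoiding
  -- twice as many vertices; hence the factor 2 in `N-large`.
  endpoints : List (V (L G)) → List (V G)
  endpoints [] = []
  endpoints (a ∷ F) = proj₁ (ends a) ∷ proj₂ (ends a) ∷ endpoints F

  length-endpoints : ∀ F → length (endpoints F) ≡ length F * 2
  length-endpoints [] = refl
  length-endpoints (_ ∷ F) = cong (2 +_) (length-endpoints F)

  ∈-endpoints : ∀ {x a F} → Inc x a → a ∈ F → x ∈ endpoints F
  ∈-endpoints (fst eq) (here refl) = here eq
  ∈-endpoints (snd eq) (here refl) = there (here eq)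
  ∈-endpoints i (there a∈) = there (there (∈-endpoints i a∈))

-- Equality of the unordered pairs {x, y} and {a, b}: a path may traverse its assigned edge in
-- either direction.
Edge : {A : Set} → A → A → A → A → Set
Edge a b x y = (x ≡ a × y ≡ b) ⊎ (x ≡ b × y ≡ a)

Edge-sym : {A : Set} {a b x y : A} → Edge a b x y → Edge a b y x
Edge-sym (inj₁ (p , q)) = inj₂ (q , p)
Edge-sym (inj₂ (p , q)) = inj₁ (q , p)

Edge-end : {A : Set} {a b c x y : A} → Edge a b x y → Edge a c x y → b ≡ c
Edge-end (inj₁ (refl , refl)) (inj₁ (_ , eq)) = eq
Edge-end (inj₁ (refl , refl)) (inj₂ (eq , eq′)) = ≡.trans eq′ eq
Edge-end (inj₂ (refl , refl)) (inj₁ (eq , eq′)) = ≡.trans eq eq′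
Edge-end (inj₂ (refl , refl)) (inj₂ (eq , _)) = eq

Edge-start : {A : Set} {a b c d x y : A} → Edge a b x y → Edge c d x y → a ≡ c ⊎ a ≡ d
Edge-start (inj₁ (refl , _)) (inj₁ (eq , _)) = inj₁ eq
Edge-start (inj₁ (refl , _)) (inj₂ (eq , _)) = inj₂ eq
Edge-start (inj₂ (_ , refl)) (inj₁ (_ , eq)) = inj₂ eq
Edge-start (inj₂ (_ , refl)) (inj₂ (_ , eq)) = inj₁ eq

-- The graph

-- A clique on κ 0, …, κ (N − 1), with N large, and two adjacent vertices u and v: u is joined to the
-- first r clique vertices and v to the next q − r. Hence u has degree r + 1 and the edge uv has degree q in L G.
module Construction (r q B N : ℕ) (r+r<q : r + r < q) (B-large : 5 + (q + q * 9) ≤ B) (N-large : 1 + (B + 10) * 2 < N) where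

  pattern u = zero
  pattern v = suc zero
  pattern κ k = suc (suc k)

  Rel : Fin (2 + N) → Fin (2 + N) → Set
  Rel u     u     = Empty
  Rel u     v     = ⊤
  Rel u     (κ k) = Fin.toℕ k < r
  Rel v     u     = ⊤
  Rel v     v     = Empty
  Rel v     (κ k) = r ≤ Fin.toℕ k × Fin.toℕ k < q
  Rel (κ k) u     = Fin.toℕ k < r
  Rel (κ k) v     = r ≤ Fin.toℕ k × Fin.toℕ k < q
  Rel (κ k) (κ l) = k ≢ l

  Rel? : ∀ x y → Dec (Rel x y)
  Rel? u     u     = no id
  Rel? u     v     = yes tt
  Rel? u     (κ k) = Fin.toℕ k ℕ.<? r
  Rel? v     u     = yes tt
  Rel? v     v     = no id
  Rel? v     (κ k) = r ℕ.≤? Fin.toℕ k ×-dec Fin.toℕ k ℕ.<? q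
  Rel? (κ k) u     = Fin.toℕ k ℕ.<? r
  Rel? (κ k) v     = r ℕ.≤? Fin.toℕ k ×-dec Fin.toℕ k ℕ.<? q
  Rel? (κ k) (κ l) = ¬? (k Fin.≟ l)

  Rel-sym : ∀ x y → Rel x y → Rel y x
  Rel-sym u     v     = id
  Rel-sym u     (κ k) = id
  Rel-sym v     u     = id
  Rel-sym v     (κ k) = id
  Rel-sym (κ k) u     = id
  Rel-sym (κ k) v     = id
  Rel-sym (κ k) (κ l) = _∘ ≡.sym

  Rel-irrefl : ∀ x → ¬ Rel x x
  Rel-irrefl u     = id
  Rel-irrefl v     = id
  Rel-irrefl (κ k) k≢k = k≢k refl

  G : Graph
  G = record
    { n = 2 + N
    ; adj = λ x y → does (Rel? x y)
    ; sym = λ x y → does-⇔ (mk⇔ (Rel-sym x y) (Rel-sym y x)) (Rel? x y) (Rel? y x)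
    ; irrefl = λ x → dec-false (Rel? x x) (Rel-irrefl x) }

  Rel⇒Adj : ∀ x y → Rel x y → Adj G x y
  Rel⇒Adj x y = dec-true (Rel? x y)

  Adj⇒Rel : ∀ x y → Adj G x y → Rel x y
  Adj⇒Rel x y xy with Rel? x y
  ... | yes rel = rel

  κ-injective : ∀ {k l : Fin N} → _≡_ {A = V G} (κ k) (κ l) → k ≡ l
  κ-injective refl = refl

  1+B+10<N : suc (B + 10) < N
  1+B+10<N = ≤-trans (s≤s (s≤s (m≤m*n (B + 10) 2))) N-large

  q≤B : q ≤ B
  q≤B = ≤-trans (m≤n⇒m≤o+n 5 (m≤m+n q (q * 9))) B-large

  q≤N : q ≤ N
  q≤N = ≤-trans q≤B (≤-trans (m≤m+n B 10) (≤-trans (m≤n+m (B + 10) 2) 1+B+10<N))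

  r<q : r < q
  r<q = ≤-trans (s≤s (m≤m+n r r)) r+r<q

  -- xs stands for the q reserved clique vertices (or neighbours of uv), ys for S.
  room : ∀ {A : Set} (x y : A) xs ys {m} → length xs ≡ q → length ys ≡ 3 → m ≤ q →
    length (x ∷ y ∷ xs ++ ys) + m * 9 ≤ B
  room x y xs ys {m} xs≡ ys≡ m≤q = ≤-trans (+-mono-≤ (≤-reflexive size) (*-monoˡ-≤ 9 m≤q))
    (≤-trans (≤-reflexive (+-assoc 5 q (q * 9))) B-large)
    where
    size : length (x ∷ y ∷ xs ++ ys) ≡ 5 + q
    size = ≡.trans (cong (2 +_) (≡.trans (length-++ xs) (≡.cong₂ _+_ xs≡ ys≡))) (cong (2 +_) (+-comm q 3))

  κ[_] : ∀ {k} → k < q → Fin N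
  κ[ k<q ] = Fin.fromℕ< (≤-trans k<q q≤N)

  toℕ-κ[_] : ∀ {k} (k<q : k < q) → Fin.toℕ κ[ k<q ] ≡ k
  toℕ-κ[ k<q ] = Fin.toℕ-fromℕ< (≤-trans k<q q≤N)

  κ[]-injective : ∀ {k l} (k<q : k < q) (l<q : l < q) → _≡_ {A = V G} (κ κ[ k<q ]) (κ κ[ l<q ]) → k ≡ l
  κ[]-injective k<q l<q eq =
    ≡.trans (≡.sym toℕ-κ[ k<q ]) (≡.trans (cong Fin.toℕ (κ-injective eq)) toℕ-κ[ l<q ])

  -- Disjoint paths in the graph itself

  module InG where

    K : V G → Set
    K x = ∃ λ k → x ≡ κ k

    -- One fresh clique vertex would already connect `x` to `y`; a second is inserted to match the
    -- form forced by the line graph.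
    bridge : ∀ F → length F ≤ B + 10 → ∀ {x y} → K x → K y → x ∈ F → y ∈ F →
      ∃₂ λ w w′ → w ∉ F × w′ ∉ F × w ≢ w′ × Adj G x w × Adj G w w′ × Adj G w′ y
    bridge F F≤ (k , refl) (l , refl) x∈ y∈
      with fresh κ κ-injective F (≤-trans (s≤s (m≤n⇒m≤1+n F≤)) 1+B+10<N)
    ... | i , i∉ with fresh κ κ-injective (κ i ∷ F) (≤-trans (s≤s (s≤s F≤)) 1+B+10<N)
    ... | j , j∉ = κ i , κ j , i∉ , j∉ ∘ there , (λ eq → j∉ (here (≡.sym eq)))
        , Rel⇒Adj (κ k) (κ i) (λ { refl → i∉ x∈ })
        , Rel⇒Adj (κ i) (κ j) (λ { refl → j∉ (here refl) })
        , Rel⇒Adj (κ j) (κ l) (λ { refl → j∉ (there y∈) })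

    open Trails G K B bridge

    xs<q : (i : Fin r) → Fin.toℕ i < q
    xs<q i = ≤-trans (Fin.toℕ<n i) (≤-trans (m≤n+m r 1) r<q)

    -- At the last index this is exactly `r + r < q`.
    ys<q : (i : Fin (suc r)) → r + Fin.toℕ i < q
    ys<q i = ≤-trans (s≤s (+-monoʳ-≤ r (s≤s⁻¹ (Fin.toℕ<n i)))) r+r<q

    -- All neighbours of `u`, one for each path; index zero marks the path that uses the edge uv
    -- whenever `u` is in `S`.
    x : Fin (suc r) → V G
    x zero    = v
    x (suc i) = κ κ[ xs<q i ]

    y : Fin (suc r) → V G
    y i = κ κ[ ys<q i ]

    x-injective : ∀ {i j} → x i ≡ x j → i ≡ j
    x-injective {zero}  {zero}  _  = refl
    x-injective {suc i} {suc j} eq = cong suc (Fin.toℕ-injective (κ[]-injective (xs<q i) (xs<q j) eq))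

    y-injective : ∀ {i j} → y i ≡ y j → i ≡ j
    y-injective {i} {j} eq = Fin.toℕ-injective (+-cancelˡ-≡ r _ _ (κ[]-injective (ys<q i) (ys<q j) eq))

    x≢y : ∀ i j → x i ≢ y j
    x≢y (suc i) j eq = <⇒≱ (Fin.toℕ<n i)
      (subst (r ≤_) (≡.sym (κ[]-injective (xs<q i) (ys<q j) eq)) (m≤m+n r _))

    u-x : ∀ i → Adj G u (x i)
    u-x zero    = refl
    u-x (suc i) = Rel⇒Adj u (x (suc i)) (subst (_< r) (≡.sym toℕ-κ[ xs<q i ]) (Fin.toℕ<n i))

    v-y : ∀ i → Adj G v (y i)
    v-y i = Rel⇒Adj v (y i) (subst (λ k → r ≤ k × k < q) (≡.sym toℕ-κ[ ys<q i ]) (m≤m+n r _ , ys<q i))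

    neighbours-of-u : ∀ {w} → Adj G u w → ∃ λ i → w ≡ x i
    neighbours-of-u {v}   _  = zero , refl
    neighbours-of-u {κ k} uk = suc (Fin.fromℕ< k<r) , cong κ (Fin.toℕ-injective
        (≡.sym (≡.trans toℕ-κ[ xs<q (Fin.fromℕ< k<r) ] (Fin.toℕ-fromℕ< k<r))))
      where k<r = Adj⇒Rel u (κ k) uk

    A : Subset (n G) → Fin (suc r) → V G → Set
    A S i w = w ∈ˢ S ⊎ w ≡ x i ⊎ w ≡ y i

    -- The only direct steps between reserved vertices. For index zero the first edge is uv itself.
    T : Fin (suc r) → V G → V G → Set
    T i a b = Edge u (x i) a b ⊎ Edge v (y i) a b

    clique-start : List (V G)
    clique-start = tabulate {n = q} (λ i → κ κ[ Fin.toℕ<n i ])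

    κ∈clique-start : ∀ {k} (k<q : k < q) → κ κ[ k<q ] ∈ clique-start
    κ∈clique-start k<q = subst (_∈ clique-start) same (∈-tabulate⁺ {f = λ i → κ κ[ Fin.toℕ<n i ]} (Fin.fromℕ< k<q))
      where
      same : _≡_ {A = V G} (κ κ[ Fin.toℕ<n (Fin.fromℕ< k<q) ]) (κ κ[ k<q ])
      same = cong (λ l → κ l) (Fin.toℕ-injective (≡.trans toℕ-κ[ Fin.toℕ<n (Fin.fromℕ< k<q) ]
        (≡.trans (Fin.toℕ-fromℕ< k<q) (≡.sym toℕ-κ[ k<q ]))))

    F₀ : Subset (n G) → List (V G)
    F₀ S = u ∷ v ∷ clique-start ++ proj₁ (elements S)

    κ∈F₀ : ∀ S {k} (k<q : k < q) → κ κ[ k<q ] ∈ F₀ S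
    κ∈F₀ S k<q = there (there (∈-++⁺ˡ (κ∈clique-start k<q)))

    S⊆F₀ : ∀ S {w} → w ∈ˢ S → w ∈ F₀ S
    S⊆F₀ S w∈ = there (there (∈-++⁺ʳ clique-start (to (proj₂ (proj₂ (proj₂ (elements S)))) w∈)))

    x∈F₀ : ∀ S i → x i ∈ F₀ S
    x∈F₀ S zero    = there (here refl)
    x∈F₀ S (suc i) = κ∈F₀ S (xs<q i)

    y∈F₀ : ∀ S i → y i ∈ F₀ S
    y∈F₀ S i = κ∈F₀ S (ys<q i)

    A⊆F₀ : ∀ S i {w} → A S i w → w ∈ F₀ S
    A⊆F₀ S i (inj₁ w∈)          = S⊆F₀ S w∈
    A⊆F₀ S i (inj₂ (inj₁ refl)) = x∈F₀ S i
    A⊆F₀ S i (inj₂ (inj₂ refl)) = y∈F₀ S i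

    A-disjoint : ∀ S i j → i ≢ j → ∀ {w} → A S i w → A S j w → w ∈ˢ S
    A-disjoint S i j i≢j (inj₁ w∈) _ = w∈
    A-disjoint S i j i≢j (inj₂ _) (inj₁ w∈) = w∈
    A-disjoint S i j i≢j (inj₂ (inj₁ refl)) (inj₂ (inj₁ eq)) = contradiction (x-injective eq) i≢j
    A-disjoint S i j i≢j (inj₂ (inj₁ refl)) (inj₂ (inj₂ eq)) = contradiction eq (x≢y i j)
    A-disjoint S i j i≢j (inj₂ (inj₂ refl)) (inj₂ (inj₁ eq)) = contradiction (≡.sym eq) (x≢y j i)
    A-disjoint S i j i≢j (inj₂ (inj₂ refl)) (inj₂ (inj₂ eq)) = contradiction (y-injective eq) i≢j

    -- Although `x zero` is `v`, an edge at `u` is never one of the edges `v`-`y j`, because `u`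
    -- differs from `v` and from every `y j`.
    T-disjoint : ∀ i j → i ≢ j → ∀ {a b} → T i a b → ¬ T j a b
    T-disjoint i j i≢j (inj₁ t) (inj₁ t′) = i≢j (x-injective (Edge-end t t′))
    T-disjoint i j i≢j (inj₂ t) (inj₂ t′) = i≢j (y-injective (Edge-end t t′))
    T-disjoint i j i≢j (inj₁ t) (inj₂ t′) = [ (λ ()) , (λ ()) ]′ (Edge-start t t′)
    T-disjoint i j i≢j (inj₂ t) (inj₁ t′) = [ (λ ()) , (λ ()) ]′ (Edge-start t′ t)

    module _ (S : Subset (n G)) (i : Fin (suc r)) {F} (F≤B : length F ≤ B)
      (F₀⊆F : ∀ {w} → w ∈ F₀ S → w ∈ F) where

      Goal : Set
      Goal = ∃₂ λ W t → Trail (T i) F W 9 t × (∀ {w} → w ∈ W → A S i w) × (∀ {w} → w ∈ˢ S → w ∈ W)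

      u∈F : u ∈ F
      u∈F = F₀⊆F (here refl)

      v∈F : v ∈ F
      v∈F = F₀⊆F (there (here refl))

      x∈F : x i ∈ F
      x∈F = F₀⊆F (x∈F₀ S i)

      y∈F : y i ∈ F
      y∈F = F₀⊆F (y∈F₀ S i)

      S∈F : ∀ {xs w} → Enumerates S xs → w ∈ xs → w ∈ F
      S∈F E w∈ = F₀⊆F (S⊆F₀ S (from E w∈))

      clique-trail : ∀ {a b c} → Enumerates S (κ a ∷ κ b ∷ κ c ∷ []) → a ≢ b → a ≢ c → b ≢ c → Goal
      clique-trail E a≢b a≢c b≢c = _ , _
        , relax id id (m≤m+n 7 2) (triple F≤B (_ , refl) (_ , refl) (_ , refl)
            (S∈F E (here refl)) (S∈F E (there (here refl))) (S∈F E (there (there (here refl))))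
            (a≢b ∘ κ-injective) (a≢c ∘ κ-injective) (b≢c ∘ κ-injective))
        , inj₁ ∘ from E , to E

      v-trail : ∀ {b c} → Enumerates S (v ∷ κ b ∷ κ c ∷ []) → b ≢ c → Goal
      v-trail E b≢c = _ , _
        , relax id id (m≤m+n 8 1) (cons v∈F (All¬⇒¬Any ((λ ()) ∷ (λ ()) ∷ (λ ()) ∷ [])) (v-y i) (inj₂ (inj₁ (refl , refl)))
            (fan F≤B (_ , refl) (_ , refl) (_ , refl) y∈F (S∈F E (there (here refl))) (S∈F E (there (there (here refl))))
              (b≢c ∘ κ-injective)))
        , (λ { (here eq) → inj₁ (from E (here eq)) ; (there (here eq)) → inj₂ (inj₂ eq)
             ; (there (there w∈)) → inj₁ (from E (there w∈)) })
        , λ w∈ → insert-second (to E w∈)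

    -- At index zero the assigned neighbour is `v`, which is outside the clique, so the path must go
    -- on to `y zero` before `bridge` applies. Its nine vertices attain the bound in `Family`.
    u-trail : ∀ S i {F} (F≤B : length F ≤ B) (F₀⊆F : ∀ {w} → w ∈ F₀ S → w ∈ F) →
      ∀ {b c} → Enumerates S (u ∷ κ b ∷ κ c ∷ []) → b ≢ c → Goal S i F≤B F₀⊆F
    u-trail S zero F≤B F₀⊆F E b≢c = _ , _
      , cons (u∈F S zero F≤B F₀⊆F) (All¬⇒¬Any ((λ ()) ∷ (λ ()) ∷ (λ ()) ∷ (λ ()) ∷ [])) refl (inj₁ (inj₁ (refl , refl)))
          (cons (v∈F S zero F≤B F₀⊆F) (All¬⇒¬Any ((λ ()) ∷ (λ ()) ∷ (λ ()) ∷ [])) (v-y zero) (inj₂ (inj₁ (refl , refl)))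
            (fan F≤B (_ , refl) (_ , refl) (_ , refl) (y∈F S zero F≤B F₀⊆F)
              (S∈F S zero F≤B F₀⊆F E (there (here refl))) (S∈F S zero F≤B F₀⊆F E (there (there (here refl))))
              (b≢c ∘ κ-injective)))
      , (λ { (here eq) → inj₁ (from E (here eq)) ; (there (here eq)) → inj₂ (inj₁ eq)
           ; (there (there (here eq))) → inj₂ (inj₂ eq)
           ; (there (there (there w∈))) → inj₁ (from E (there w∈)) })
      , λ w∈ → insert-second (insert-second (to E w∈))
    u-trail S i@(suc _) F≤B F₀⊆F E b≢c = _ , _
      , relax id id (m≤m+n 8 1)
          (cons (u∈F S i F≤B F₀⊆F) (All¬⇒¬Any ((λ ()) ∷ (λ ()) ∷ (λ ()) ∷ [])) (u-x i) (inj₁ (inj₁ (refl , refl)))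
            (fan F≤B (_ , refl) (_ , refl) (_ , refl) (x∈F S i F≤B F₀⊆F)
              (S∈F S i F≤B F₀⊆F E (there (here refl))) (S∈F S i F≤B F₀⊆F E (there (there (here refl))))
              (b≢c ∘ κ-injective)))
      , (λ { (here eq) → inj₁ (from E (here eq)) ; (there (here eq)) → inj₂ (inj₁ eq)
           ; (there (there w∈)) → inj₁ (from E (there w∈)) })
      , λ w∈ → insert-second (to E w∈)

    -- One path is u, v, …, a; every other one reaches a from u through x i and then v through y i.
    uv-trail : ∀ S i {F} (F≤B : length F ≤ B) (F₀⊆F : ∀ {w} → w ∈ F₀ S → w ∈ F) →
      ∀ {a} → Enumerates S (u ∷ v ∷ κ a ∷ []) → Goal S i F≤B F₀⊆F
    uv-trail S zero F≤B F₀⊆F {a} E = _ , _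
      , relax id id (m≤m+n 6 3)
          (cons (u∈F S zero F≤B F₀⊆F) (All¬⇒¬Any ((λ ()) ∷ (λ ()) ∷ (λ ()) ∷ [])) refl (inj₁ (inj₁ (refl , refl)))
            (cons (v∈F S zero F≤B F₀⊆F) (All¬⇒¬Any ((λ ()) ∷ (λ ()) ∷ [])) (v-y zero) (inj₂ (inj₁ (refl , refl)))
              (meet F≤B (s≤s z≤n) (_ , refl) (_ , refl) (y∈F S zero F≤B F₀⊆F) (position (y zero Fin.≟ κ a)) (single (κ a)))))
      , (λ { (here eq) → inj₁ (from E (here eq)) ; (there (here eq)) → inj₁ (from E (there (here eq)))
           ; (there (there (here eq))) → inj₂ (inj₂ eq)
           ; (there (there (there w∈))) → inj₁ (from E (there (there w∈))) })
      , λ w∈ → reorder (to E w∈)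
      where
      position : Dec (y zero ≡ κ a) → y zero ≡ κ a ⊎ y zero ∉ κ a ∷ []
      position (yes eq) = inj₁ eq
      position (no neq) = inj₂ (All¬⇒¬Any (neq ∷ []))
      reorder : ∀ {w} → w ∈ u ∷ v ∷ κ a ∷ [] → w ∈ u ∷ v ∷ y zero ∷ κ a ∷ []
      reorder (here eq) = here eq
      reorder (there (here eq)) = there (here eq)
      reorder (there (there w∈)) = there (there (there w∈))
    uv-trail S i@(suc _) F≤B F₀⊆F {a} E = _ , _
      , cons (u∈F S i F≤B F₀⊆F) (All¬⇒¬Any ((λ ()) ∷ (λ ()) ∷ (λ ()) ∷ (λ ()) ∷ [])) (u-x i) (inj₁ (inj₁ (refl , refl)))
          -- The vertex `a` may equal `x i` or `y i`; `meet` then drops the corresponding detour.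
          (meet F≤B (m≤m+n 5 5) (_ , refl) (_ , refl) (x∈F S i F≤B F₀⊆F) (x-position (x i Fin.≟ κ a))
            (meet F≤B (m≤m+n 2 8) (_ , refl) (_ , refl) (S∈F S i F≤B F₀⊆F E (there (there (here refl)))) (a-position (κ a Fin.≟ y i))
              (cons (y∈F S i F≤B F₀⊆F) (All¬⇒¬Any ((λ ()) ∷ [])) (≡.trans (Graph.sym G (y i) v) (v-y i)) (inj₂ (inj₂ (refl , refl)))
                (single v))))
      , (λ { (here eq) → inj₁ (from E (here eq)) ; (there (here eq)) → inj₂ (inj₁ eq)
           ; (there (there (here eq))) → inj₁ (from E (there (there (here eq))))
           ; (there (there (there (here eq)))) → inj₂ (inj₂ eq)
           ; (there (there (there (there (here eq))))) → inj₁ (from E (there (here eq))) })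
      , λ w∈ → reorder (to E w∈)
      where
      x-position : Dec (x i ≡ κ a) → x i ≡ κ a ⊎ x i ∉ κ a ∷ y i ∷ v ∷ []
      x-position (yes eq) = inj₁ eq
      x-position (no neq) = inj₂ (All¬⇒¬Any (neq ∷ x≢y i i ∷ (λ ()) ∷ []))
      a-position : Dec (κ a ≡ y i) → κ a ≡ y i ⊎ κ a ∉ y i ∷ v ∷ []
      a-position (yes eq) = inj₁ eq
      a-position (no neq) = inj₂ (All¬⇒¬Any (neq ∷ (λ ()) ∷ []))
      reorder : ∀ {w} → w ∈ u ∷ v ∷ κ a ∷ [] → w ∈ u ∷ x i ∷ κ a ∷ y i ∷ v ∷ []
      reorder (here eq) = here eq
      reorder (there (here eq)) = there (there (there (there (here eq))))
      reorder (there (there (here eq))) = there (there (here eq))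

    -- Since `u` and `v` are the vertices 0 and 1, the first two entries of the vector tell which of
    -- them belong to `S`.
    family : ∀ S → ∣ S ∣ ≡ 3 → Family S (A S) T (F₀ S)
    family (inside Vec.∷ inside Vec.∷ S) size i F F≤B F₀⊆F =
      let a , E = one-element S (ℕ.suc-injective (ℕ.suc-injective size))
      in uv-trail _ i F≤B F₀⊆F (enumerates-inside (enumerates-inside E))
    family (inside Vec.∷ outside Vec.∷ S) size i F F≤B F₀⊆F =
      let b , c , b≢c , E = two-elements S (ℕ.suc-injective size)
      in u-trail _ i F≤B F₀⊆F (enumerates-inside (enumerates-outside E)) b≢c
    family (outside Vec.∷ inside Vec.∷ S) size i F F≤B F₀⊆F =
      let b , c , b≢c , E = two-elements S (ℕ.suc-injective size)
      in v-trail _ i F≤B F₀⊆F (enumerates-outside (enumerates-inside E)) b≢c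
    family (outside Vec.∷ outside Vec.∷ S) size i F F≤B F₀⊆F =
      let a , b , c , a≢b , a≢c , b≢c , E = three-elements S size
      in clique-trail _ i F≤B F₀⊆F (enumerates-outside (enumerates-outside E)) a≢b a≢c b≢c

    lower : ∀ S → ∣ S ∣ ≡ 3 → HasDisjointSPaths G S (suc r)
    lower S size = disjoint-paths S (A S) T (F₀ S)
      (room {A = V G} u v clique-start (proj₁ (elements S)) (length-tabulate {n = q} _) (≡.trans (proj₁ (proj₂ (elements S))) size) r<q)
      (family S size) (S⊆F₀ S) (A⊆F₀ S) (A-disjoint S)
      (λ i → [ inj₁ ∘ Edge-sym , inj₂ ∘ Edge-sym ]′) T-disjoint

    π₃-G : PathConn 3 G (suc r)
    π₃-G with fresh κ κ-injective [] (≤-trans (s≤s z≤n) 1+B+10<N)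
    -- What matters for the upper bound is that the set contains `u`, whose neighbours are exactly
    -- the `r + 1` values of `x`.
    ... | k , _ with fromUnique (u ∷ v ∷ κ k ∷ []) (((λ ()) ∷ (λ ()) ∷ []) ∷ ((λ ()) ∷ []) ∷ [] ∷ [])
    ... | S , size , E = s≤s (s≤s z≤n) , subst (_≤ 2 + N) size (∣p∣≤n S) , lower
        , S , size , lower S size
        , degree-bound G S x neighbours-of-u (from E (here refl)) (subst (2 ≤_) (≡.sym size) (s≤s (s≤s z≤n)))

  -- Disjoint paths in the line graph

  module InLineGraph (3≤q : 3 ≤ q) where
    open LineGraph G

    e : V (L G)
    e = proj₁ (edge {u} {v} refl)

    e-joins : Joins u v e
    e-joins = proj₂ (edge {u} {v} refl)

    κ∉e : ∀ {k} → ¬ Inc (κ k) e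
    κ∉e = [ (λ ()) , (λ ()) ]′ ∘ Inc-Joins e-joins

    K : V (L G) → Set
    K a = ∃ λ k → Inc (κ k) a

    -- Stored pairs are increasing and `u`, `v` are the two least vertices, so a pair whose larger
    -- end is outside the clique can only be uv.
    clique-end : ∀ {a} → a ≢ e → K a
    clique-end {a} a≢e = go (proj₁ (ends a)) (proj₂ (ends a)) refl (proj₁ (ends-edge a))
      where
      go : ∀ i j → ends a ≡ (i , j) → i Fin.< j → K a
      go i (κ k) eq _ = k , snd (≡.sym (cong proj₂ eq))
      go u v eq _ = contradiction (Joins-unique (forth eq) e-joins) a≢e
      go v v eq (s≤s ())
      go (κ _) v eq (s≤s ())

    link : ∀ {k l} → k ≢ l → ∃ (Joins (κ k) (κ l))
    link {k} {l} k≢l = edge (Rel⇒Adj (κ k) (κ l) k≢l)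

    -- An edge with an end off `endpoints F` is new. If the clique ends `k` and `l` of `a` and `b`
    -- differ, go through the edges `k`-`i` and `i`-`l` for a fresh `i`. If they agree, these would
    -- coincide, so a second fresh vertex `j` supplies `k`-`i` and `k`-`j`, which meet at `k`.
    bridge : ∀ F → length F ≤ B + 10 → ∀ {a b} → K a → K b → a ∈ F → b ∈ F →
      ∃₂ λ w w′ → w ∉ F × w′ ∉ F × w ≢ w′ × Adj (L G) a w × Adj (L G) w w′ × Adj (L G) w′ b
    bridge F F≤ {a} {b} (k , ka) (l , lb) a∈ b∈ = go (k Fin.≟ l)
      where
      ends≤ : length (endpoints F) ≤ (B + 10) * 2
      ends≤ = ≤-trans (≤-reflexive (length-endpoints F)) (*-monoˡ-≤ 2 F≤)
      new-i : ∃ λ i → κ i ∉ endpoints F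
      new-i = fresh κ κ-injective (endpoints F) (≤-trans (s≤s (m≤n⇒m≤1+n ends≤)) N-large)
      i : Fin N
      i = proj₁ new-i
      new-j : ∃ λ j → κ j ∉ κ i ∷ endpoints F
      new-j = fresh κ κ-injective (κ i ∷ endpoints F) (≤-trans (s≤s (s≤s ends≤)) N-large)
      j : Fin N
      j = proj₁ new-j
      outside-F : ∀ {x w} → Inc x w → x ∉ endpoints F → w ∉ F
      outside-F xw x∉ w∈ = x∉ (∈-endpoints xw w∈)
      k≢ : ∀ {m} → κ m ∉ endpoints F → k ≢ m
      k≢ m∉ refl = m∉ (∈-endpoints ka a∈)
      i≢l : i ≢ l
      i≢l i≡l = proj₂ new-i (subst (λ m → κ m ∈ endpoints F) (≡.sym i≡l) (∈-endpoints lb b∈))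

      through : ∀ {c d m} → c ∉ F → d ∉ F → c ≢ d → Inc (κ k) c → Inc m c → Inc m d → Inc (κ l) d →
        ∃₂ λ w w′ → w ∉ F × w′ ∉ F × w ≢ w′ × Adj (L G) a w × Adj (L G) w w′ × Adj (L G) w′ b
      through c∉F d∉F c≢d kc mc md ld = _ , _ , c∉F , d∉F , c≢d
        , meet⇒Adj (λ a≡c → c∉F (subst (_∈ F) a≡c a∈)) ka kc
        , meet⇒Adj c≢d mc md
        , meet⇒Adj (λ d≡b → d∉F (subst (_∈ F) (≡.sym d≡b) b∈)) ld lb

      c : ∃ (Joins (κ k) (κ i))
      c = link (k≢ (proj₂ new-i))
      c∉F : proj₁ c ∉ F
      c∉F = outside-F (Joins⇒Incʳ (proj₂ c)) (proj₂ new-i)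

      go : Dec (k ≡ l) → ∃₂ λ w w′ → w ∉ F × w′ ∉ F × w ≢ w′ × Adj (L G) a w × Adj (L G) w w′ × Adj (L G) w′ b
      go (no k≢l) = through c∉F (outside-F (Joins⇒Incˡ (proj₂ d)) (proj₂ new-i)) c≢d
          (Joins⇒Incˡ (proj₂ c)) (Joins⇒Incʳ (proj₂ c)) (Joins⇒Incˡ (proj₂ d)) (Joins⇒Incʳ (proj₂ d))
        where
        d : ∃ (Joins (κ i) (κ l))
        d = link i≢l
        c≢d : proj₁ c ≢ proj₁ d
        c≢d eq = [ k≢l ∘ ≡.sym ∘ κ-injective , i≢l ∘ ≡.sym ∘ κ-injective ]′
          (Inc-Joins (proj₂ c) (subst (Inc (κ l)) (≡.sym eq) (Joins⇒Incʳ (proj₂ d))))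
      go (yes k≡l) = through c∉F (outside-F (Joins⇒Incʳ (proj₂ d)) (proj₂ new-j ∘ there)) c≢d
          (Joins⇒Incˡ (proj₂ c)) (Joins⇒Incˡ (proj₂ c)) (Joins⇒Incˡ (proj₂ d))
          (subst (λ m → Inc (κ m) (proj₁ d)) k≡l (Joins⇒Incˡ (proj₂ d)))
        where
        d : ∃ (Joins (κ k) (κ j))
        d = link (k≢ (proj₂ new-j ∘ there))
        c≢d : proj₁ c ≢ proj₁ d
        c≢d eq = [ k≢ (proj₂ new-j ∘ there) ∘ ≡.sym ∘ κ-injective , proj₂ new-j ∘ here ]′
          (Inc-Joins (proj₂ c) (subst (Inc (κ j)) (≡.sym eq) (Joins⇒Incʳ (proj₂ d))))

    open Trails (L G) K B bridge

    Low : V G → Set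
    Low x = x ≡ u ⊎ x ≡ v

    -- The neighbourhoods of `u` and `v` partition the first `q` clique vertices, so the neighbours
    -- of `e` in `L G` can be indexed by their clique ends.
    hub : ∀ k → Fin.toℕ k < q → ∃ λ x → Low x × Rel x (κ k)
    hub k k<q with Fin.toℕ k ℕ.<? r
    ... | yes k<r = u , inj₁ refl , k<r
    ... | no k≮r = v , inj₂ refl , ℕ.≮⇒≥ k≮r , k<q

    hub-unique : ∀ {x y k} → Low x → Low y → Rel x (κ k) → Rel y (κ k) → x ≡ y
    hub-unique (inj₁ refl) (inj₁ refl) _ _ = refl
    hub-unique (inj₂ refl) (inj₂ refl) _ _ = refl
    hub-unique (inj₁ refl) (inj₂ refl) k<r (r≤k , _) = contradiction r≤k (<⇒≱ k<r)
    hub-unique (inj₂ refl) (inj₁ refl) (r≤k , _) k<r = contradiction r≤k (<⇒≱ k<r)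

    hub-edge : ∀ k (k<q : Fin.toℕ k < q) → ∃ (Joins (proj₁ (hub k k<q)) (κ k))
    hub-edge k k<q = edge (Rel⇒Adj _ (κ k) (proj₂ (proj₂ (hub k k<q))))

    pos : Fin q → Fin N
    pos i = κ[ Fin.toℕ<n i ]

    pos<q : ∀ i → Fin.toℕ (pos i) < q
    pos<q i = subst (_< q) (≡.sym toℕ-κ[ Fin.toℕ<n i ]) (Fin.toℕ<n i)

    f : Fin q → V (L G)
    f i = proj₁ (hub-edge (pos i) (pos<q i))

    f-joins : ∀ i → Joins (proj₁ (hub (pos i) (pos<q i))) (κ (pos i)) (f i)
    f-joins i = proj₂ (hub-edge (pos i) (pos<q i))

    f-low : ∀ i → Low (proj₁ (hub (pos i) (pos<q i)))
    f-low i = proj₁ (proj₂ (hub (pos i) (pos<q i)))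

    f≢e : ∀ i → f i ≢ e
    f≢e i eq = κ∉e (subst (Inc (κ (pos i))) eq (Joins⇒Incʳ (f-joins i)))

    f-K : ∀ i → K (f i)
    f-K i = pos i , Joins⇒Incʳ (f-joins i)

    Low⇒Inc : ∀ {x} → Low x → Inc x e
    Low⇒Inc (inj₁ refl) = Joins⇒Incˡ e-joins
    Low⇒Inc (inj₂ refl) = Joins⇒Incʳ e-joins

    e-f : ∀ i → Adj (L G) e (f i)
    e-f i = meet⇒Adj (f≢e i ∘ ≡.sym) (Low⇒Inc (f-low i)) (Joins⇒Incˡ (f-joins i))

    κ-not-low : ∀ {x k} → Low x → κ k ≢ x
    κ-not-low (inj₁ refl) ()
    κ-not-low (inj₂ refl) ()

    f-injective : ∀ {i j} → f i ≡ f j → i ≡ j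
    f-injective {i} {j} eq = [ (λ p → contradiction p (κ-not-low (f-low j)))
                             , Fin.toℕ-injective ∘ κ[]-injective (Fin.toℕ<n i) (Fin.toℕ<n j) ]′
      (Inc-Joins (f-joins j) (subst (Inc (κ (pos i))) eq (Joins⇒Incʳ (f-joins i))))

    -- Such an edge joins `u` or `v` to some `κ k`. Adjacency forces `k` below `q`, and as only one
    -- of `u`, `v` is adjacent to `κ k`, the edge is the one chosen in `f`.
    neighbours-of-e : ∀ {a} → Adj (L G) e a → ∃ λ i → a ≡ f i
    neighbours-of-e {a} ea with Adj⇒meet ea
    ... | e≢a , x , xe , xa with clique-end (e≢a ∘ ≡.sym)
    ... | k , ka = i , Joins-unique a-joins
                         (subst₂ (λ y l → Joins y (κ l) (f i)) (hub-unique (f-low i) low Rel-f x-k) pos≡k (f-joins i))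
      where
      low : Low x
      low = Inc-Joins e-joins xe
      a-joins : Joins x (κ k) a
      a-joins = Inc⇒Joins (κ-not-low low ∘ ≡.sym) xa ka
      x-k : Rel x (κ k)
      x-k = Adj⇒Rel x (κ k) (Joins⇒Adj a-joins)
      k<q : Fin.toℕ k < q
      k<q with low
      ... | inj₁ refl = ≤-trans x-k (≤-trans (m≤n+m r 1) r<q)
      ... | inj₂ refl = proj₂ x-k
      i : Fin q
      i = Fin.fromℕ< k<q
      pos≡k : pos i ≡ k
      pos≡k = Fin.toℕ-injective (≡.trans toℕ-κ[ Fin.toℕ<n i ] (Fin.toℕ-fromℕ< k<q))
      Rel-f : Rel (proj₁ (hub (pos i) (pos<q i))) (κ k)
      Rel-f = subst (λ l → Rel (proj₁ (hub (pos i) (pos<q i))) (κ l)) pos≡k (proj₂ (proj₂ (hub (pos i) (pos<q i))))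

    A : Subset (n (L G)) → Fin q → V (L G) → Set
    A S i w = w ∈ˢ S ⊎ w ≡ f i

    T : Fin q → V (L G) → V (L G) → Set
    T i = Edge e (f i)

    -- The second `e` is padding: it gives the list the same length as in `InG`, so that `room`
    -- serves both.
    F₀ : Subset (n (L G)) → List (V (L G))
    F₀ S = e ∷ e ∷ tabulate f ++ proj₁ (elements S)

    S⊆F₀ : ∀ S {w} → w ∈ˢ S → w ∈ F₀ S
    S⊆F₀ S w∈ = there (there (∈-++⁺ʳ (tabulate f) (to (proj₂ (proj₂ (proj₂ (elements S)))) w∈)))

    f∈F₀ : ∀ S i → f i ∈ F₀ S
    f∈F₀ S i = there (there (∈-++⁺ˡ (∈-tabulate⁺ i)))

    A-disjoint : ∀ S i j → i ≢ j → ∀ {w} → A S i w → A S j w → w ∈ˢ S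
    A-disjoint S i j i≢j (inj₁ w∈)   _         = w∈
    A-disjoint S i j i≢j (inj₂ _)    (inj₁ w∈) = w∈
    A-disjoint S i j i≢j (inj₂ refl) (inj₂ eq) = contradiction (f-injective eq) i≢j

    module _ (S : Subset (n (L G))) (i : Fin q) {F} (F≤B : length F ≤ B)
      (F₀⊆F : ∀ {w} → w ∈ F₀ S → w ∈ F) where

      Goal : Set
      Goal = ∃₂ λ W t → Trail (T i) F W 9 t × (∀ {w} → w ∈ W → A S i w) × (∀ {w} → w ∈ˢ S → w ∈ W)

      S∈F : ∀ {xs w} → Enumerates S xs → w ∈ xs → w ∈ F
      S∈F E w∈ = F₀⊆F (S⊆F₀ S (from E w∈))

      clique-trail : ∀ {a b c} → Enumerates S (a ∷ b ∷ c ∷ []) → a ≢ e → b ≢ e → c ≢ e →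
        a ≢ b → a ≢ c → b ≢ c → Goal
      clique-trail E a≢e b≢e c≢e a≢b a≢c b≢c = _ , _
        , relax id id (m≤m+n 7 2) (triple F≤B (clique-end a≢e) (clique-end b≢e) (clique-end c≢e)
            (S∈F E (here refl)) (S∈F E (there (here refl))) (S∈F E (there (there (here refl)))) a≢b a≢c b≢c)
        , inj₁ ∘ from E , to E

      e-trail : ∀ {b c} → Enumerates S (e ∷ b ∷ c ∷ []) → e ≢ b → e ≢ c → b ≢ c → Goal
      e-trail {b} {c} E e≢b e≢c b≢c = _ , _
        , relax id id (m≤m+n 8 1) (cons (F₀⊆F (here refl)) (All¬⇒¬Any ((f≢e i ∘ ≡.sym) ∷ e≢b ∷ e≢c ∷ []))
            (e-f i) (inj₁ (refl , refl))
            (fan F≤B (f-K i) (clique-end (e≢b ∘ ≡.sym)) (clique-end (e≢c ∘ ≡.sym)) (F₀⊆F (f∈F₀ S i))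
              (S∈F E (there (here refl))) (S∈F E (there (there (here refl)))) b≢c))
        , (λ { (here eq) → inj₁ (from E (here eq)) ; (there (here eq)) → inj₂ eq
             ; (there (there w∈)) → inj₁ (from E (there w∈)) })
        , λ w∈ → insert-second (to E w∈)

      trail : ∀ {a b c} → Enumerates S (a ∷ b ∷ c ∷ []) → a ≢ b → a ≢ c → b ≢ c →
        Dec (a ≡ e) → Dec (b ≡ e) → Dec (c ≡ e) → Goal
      trail E a≢b a≢c b≢c (yes a≡e) _ _ =
        e-trail (subst (λ a → Enumerates S (a ∷ _)) a≡e E) (a≢b ∘ ≡.trans a≡e) (a≢c ∘ ≡.trans a≡e) b≢c
      trail E a≢b a≢c b≢c (no a≢e) (yes b≡e) _ =
        e-trail (subst (λ b → Enumerates S (b ∷ _)) b≡e (permute exchange exchange E))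
          (a≢e ∘ ≡.sym) (b≢c ∘ ≡.trans b≡e) a≢c
      trail E a≢b a≢c b≢c (no a≢e) (no b≢e) (yes c≡e) =
        -- A rotation of three entries has order three, so its square is its inverse.
        e-trail (subst (λ c → Enumerates S (c ∷ _)) c≡e (permute rotate (rotate ∘ rotate) E))
          (a≢e ∘ ≡.sym) (b≢e ∘ ≡.sym) a≢b
      trail E a≢b a≢c b≢c (no a≢e) (no b≢e) (no c≢e) = clique-trail E a≢e b≢e c≢e a≢b a≢c b≢c

    family : ∀ S → ∣ S ∣ ≡ 3 → Family S (A S) T (F₀ S)
    family S size i F F≤B F₀⊆F =
      let a , b , c , a≢b , a≢c , b≢c , E = three-elements S size
      in trail S i F≤B F₀⊆F E a≢b a≢c b≢c (a Fin.≟ e) (b Fin.≟ e) (c Fin.≟ e)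

    lower : ∀ S → ∣ S ∣ ≡ 3 → HasDisjointSPaths (L G) S q
    lower S size = disjoint-paths S (A S) T (F₀ S)
      (room e e (tabulate f) (proj₁ (elements S)) (length-tabulate f) (≡.trans (proj₁ (proj₂ (elements S))) size) ≤-refl)
      (family S size) (S⊆F₀ S) (λ { i (inj₁ w∈) → S⊆F₀ S w∈ ; i (inj₂ refl) → f∈F₀ S i }) (A-disjoint S)
      (λ i → Edge-sym) (λ i j i≢j t t′ → i≢j (f-injective (Edge-end t t′)))

    π₃-LG : PathConn 3 (L G) q
    π₃-LG =
      -- Any set containing `e` is capped by the degree `q` of `e`; two of its neighbours complete
      -- it to three elements.
      let S , size , E = fromUnique (e ∷ f i₀ ∷ f i₁ ∷ [])
            (((f≢e i₀ ∘ ≡.sym) ∷ (f≢e i₁ ∘ ≡.sym) ∷ []) ∷ ((i₀≢i₁ ∘ f-injective) ∷ []) ∷ [] ∷ [])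
      in s≤s (s≤s z≤n) , ≤-trans (≤-reflexive (≡.sym size)) (∣p∣≤n S) , lower
        , S , size , lower S size
        , degree-bound (L G) S f neighbours-of-e (from E (here refl)) (≤-trans (s≤s (s≤s z≤n)) (≤-reflexive (≡.sym size)))
      where
      0<q : 0 < q
      0<q = ≤-trans (s≤s z≤n) 3≤q
      1<q : 1 < q
      1<q = ≤-trans (s≤s (s≤s z≤n)) 3≤q
      i₀ i₁ : Fin q
      i₀ = Fin.fromℕ< 0<q
      i₁ = Fin.fromℕ< 1<q
      i₀≢i₁ : i₀ ≢ i₁
      i₀≢i₁ eq with () ← ≡.trans (≡.sym (Fin.toℕ-fromℕ< 0<q)) (≡.trans (cong Fin.toℕ eq) (Fin.toℕ-fromℕ< 1<q))

theorem3p5 : ∀ (p q : ℕ) → 2 * p ∸ 1 ≤ q → 2 ≤ p → 3 ≤ q →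
    ∃ λ (G : Graph) → PathConn 3 G p × PathConn 3 (L G) q
theorem3p5 (suc r) q 2p-1≤q _ 3≤q = G , InG.π₃-G , InLineGraph.π₃-LG 3≤q
  where
  -- With `p = suc r`, the term `2 * p ∸ 1` computes to `r + suc (r + 0)`.
  2r<q : r + r < q
  2r<q = subst (_≤ q) (≡.trans (+-suc r (r + 0)) (cong (λ k → suc (r + k)) (+-identityʳ r))) 2p-1≤q
  B : ℕ
  -- The initial reserved list has 5 + q entries: two special vertices, `q` neighbours and the three
  -- elements of `S`. Up to `q` paths of at most 9 vertices follow.
  B = 5 + (q + q * 9)
  -- `bridge` in the line graph avoids both ends of up to `B + 10` edges, and its second fresh
  -- vertex also avoids the first; the clique has one vertex more than that.
  open Construction r q B (2 + (B + 10) * 2) 2r<q ≤-refl ≤-refl
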